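{- Let $G$ be a deterministic automaton over a finite event set $E$ with uncontrollable events $E_{uc}\subseteq E$, let $d$ be a metric on $E$ with values in $[0,1]$, and let $\lambda\in[0,1]$. Let $K\subseteq L(G)$ be a language. Then $B(K,\lambda)^{\uparrow}$ is the supremal realization of $K^{\Uparrow}$.
   Context: Setting. $E$ is a finite set of events, partitioned as $E=E_c\sqcup E_{uc}$ (controllable / uncontrollable events); $E^*$ is the set of finite strings over $E$ including the empty string $\epsilon$; $l(s)$ is the length of a string $s$; $\overline{L}$ is the prefix closure of a language $L\subseteq E^*$. $G=(Q,E,\delta,q_0)$ is a deterministic automaton with partial transition function $\delta:Q\times E\to Q$, extended to strings as usual, and $L(G)=\{s\in E^*:\delta(q_0,s)\text{ is defined}\}$ (a prefix closed language containing $\epsilon$). Metrics. $d$ is a metric on $E$ with values in $[0,1]$. Set $d(\epsilon,\epsilon)=0$ and $d(a,\epsilon)=d(\epsilon,a)=1$ for $a\in E$. For strings $s=s_1\cdots s_{l(s)}$, $t=t_1\cdots t_{l(t)}$, pad the shorter one with $\epsilon$'s and define $d(s,t)=\sum_{i=1}^{\max\{l(s),l(t)\}}2^{ -i}d(s_i,t_i)$. For a string $s$ and a language $A$, $d(s,A)=\inf_{a\in A}d(s,a)$ if $A\neq\emptyset$ and $d(s,\emptyset)=1$. For languages $A,B$, $d(A,B)$ is the Hausdorff metric: $d(\emptyset,\emptyset)=0$, and otherwise $d(A,B)=\max\{\sup_{a\in A}d(a,B),\sup_{b\in B}d(b,A)\}$ (a supremum over the empty set being $0$). Balls. For $s\in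 L(G)$, $B(s,\lambda)=\{t\in L(G):d(s,t)\le\lambda\}$, and for $K\subseteq L(G)$, $B(K,\lambda)=\bigcup_{s\in K}B(s,\lambda)$. Controllability. A language $K\subseteq L(G)$ is controllable if $\overline{K}E_{uc}\cap L(G)\subseteq\overline{K}$. $K^{\uparrow}$ denotes the supremal (largest) controllable sublanguage of $K$, i.e. the union of all controllable $M\subseteq K$. A language $K\subseteq L(G)$ is $\lambda$-controllable if there is a controllable language $\widetilde K\subseteq L(G)$ with $d(\widetilde K,K)\le\lambda$; such a $\widetilde K$ is called a realization of $K$. The supremal realization of a $\lambda$-controllable language is the union of all its realizations (which is itself a realization), i.e. its largest realization with respect to inclusion. $K^{\Uparrow}$ denotes the supremal $\lambda$-controllable sublanguage of $K$, i.e. the union of all $\lambda$-controllable languages $M\subseteq K$ (it is itself $\lambda$-controllable).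
   Formalization: The case λ = 1 with K = ∅ is excluded, since the claim is false there: B(∅,1)↑ = ∅, while L(G) is a realization of K⇑ = ∅ because d(L(G),∅) = 1 ≤ 1, so the supremal realization is L(G) ≠ ∅. -}

module Defs where

open import Axiom.ExcludedMiddle using (ExcludedMiddle)
open import Data.List.Base using (List; []; _∷_; _++_; _∷ʳ_; length; head; drop)
open import Data.Maybe using (Maybe; just; nothing; Is-just; _>>=_)
open import Data.Nat.Base as ℕ using (ℕ; zero; suc)
open import Data.Nat.GeneralisedArithmetic using (fold)
open import Data.Product using (∃; ∃-syntax; _×_; _,_; proj₁)
open import Data.Rational as ℚ using (ℚ; ½; 0ℚ; 1ℚ)
import Data.Rational.Properties as ℚ
open import Data.Sum.Base using (_⊎_; inj₁; inj₂; [_,_]′)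
import Function.Metric.Structures as Metric
open import Function.Base using (_∘_)
open import Level using (0ℓ) renaming (suc to lsuc)
open import Relation.Binary.Definitions using (tri<; tri≈; tri>)
open import Relation.Binary.PropositionalEquality
open import Relation.Nullary using (yes; no; contradiction; True)
open import Relation.Unary using (Pred; _∈_; _∉_; _⊆_; _≐_; _∩_)

------------------------------------------------------------------------
-- Real numbers, as (lower) Dedekind cuts of ℚ.  The development is
-- classical, so one-sided cuts are enough.

record ℝ : Set₁ where
  field
    cut       : Pred ℚ 0ℓ
    inhabited : ∃[ q ] q ∈ cut
    bounded   : ∃[ q ] q ∉ cut
    closed    : ∀ {p q} → p ℚ.< q → q ∈ cut → p ∈ cut
    open′     : ∀ {q} → q ∈ cut → ∃[ r ] q ℚ.< r × r ∈ cut

  below : ∀ {p q} → p ∈ cut → q ∉ cut → p ℚ.< q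
  below {p} {q} p∈ q∉ with ℚ.<-cmp p q
  ... | tri< p<q _ _    = p<q
  ... | tri≈ _ refl _   = contradiction p∈ q∉
  ... | tri> _ _ q<p    = contradiction (closed q<p p∈) q∉

open ℝ using (cut)

infix  4 _≤_ _≈_
infixl 6 _+_ _⊔_

_≤_ : ℝ → ℝ → Set
x ≤ y = cut x ⊆ cut y

_≈_ : ℝ → ℝ → Set
x ≈ y = cut x ≐ cut y

private
  halves : ∀ q → ½ ℚ.* q ℚ.+ ½ ℚ.* q ≡ q
  halves q = trans (sym (ℚ.*-distribʳ-+ q ½ ½)) (ℚ.*-identityˡ q)

  half-double : ∀ q → ½ ℚ.* (q ℚ.+ q) ≡ q
  half-double q = trans (ℚ.*-distribˡ-+ ½ q q) (halves q)

  add-sub : ∀ a p → a ℚ.+ (p ℚ.- a) ≡ p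
  add-sub a p = trans (cong (a ℚ.+_) (ℚ.+-comm p (ℚ.- a)))
    (trans (sym (ℚ.+-assoc a (ℚ.- a) p))
      (trans (cong (ℚ._+ p) (ℚ.+-inverseʳ a)) (ℚ.+-identityˡ p)))

  pred< : ∀ q → q ℚ.- 1ℚ ℚ.< q
  pred< q = subst (q ℚ.- 1ℚ ℚ.<_) (ℚ.+-identityʳ q)
    (ℚ.+-monoʳ-< q (ℚ.negative⁻¹ (ℚ.- 1ℚ)))

fromℚ : ℚ → ℝ
fromℚ q = record
  { cut       = ℚ._< q
  ; inhabited = q ℚ.- 1ℚ , pred< q
  ; bounded   = q , ℚ.<-irrefl refl
  ; closed    = ℚ.<-trans
  ; open′     = ℚ.<-dense
  }

0ℝ 1ℝ : ℝ
0ℝ = fromℚ 0ℚ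
1ℝ = fromℚ 1ℚ

_+_ : ℝ → ℝ → ℝ
x + y = record
  { cut       = λ q → ∃[ a ] ∃[ b ] a ∈ X.cut × b ∈ Y.cut × q ≡ a ℚ.+ b
  ; inhabited = let a , a∈ = X.inhabited ; b , b∈ = Y.inhabited in
                a ℚ.+ b , a , b , a∈ , b∈ , refl
  ; bounded   = let u , u∉ = X.bounded ; v , v∉ = Y.bounded in
                u ℚ.+ v , λ (a , b , a∈ , b∈ , eq) → ℚ.<-irrefl (sym eq)
                  (ℚ.+-mono-< (X.below a∈ u∉) (Y.below b∈ v∉))
  ; closed    = λ { {p} p<q (a , b , a∈ , b∈ , refl) →
                a , p ℚ.- a , a∈
                  , Y.closed (subst (p ℚ.- a ℚ.<_) (sub-add a b)
                                    (ℚ.+-monoˡ-< (ℚ.- a) p<q)) b∈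
                  , sym (add-sub a p) }
  ; open′     = λ { (a , b , a∈ , b∈ , refl) →
                let r , a<r , r∈ = X.open′ a∈ in
                r ℚ.+ b , ℚ.+-monoˡ-< b a<r , r , b , r∈ , b∈ , refl }
  }
  where
  module X = ℝ x
  module Y = ℝ y
  sub-add : ∀ a b → a ℚ.+ b ℚ.- a ≡ b
  sub-add a b = trans (ℚ.+-assoc a b (ℚ.- a)) (add-sub a b)

halve : ℝ → ℝ
halve x = record
  { cut       = λ q → q ℚ.+ q ∈ X.cut
  ; inhabited = let a , a∈ = X.inhabited in
                ½ ℚ.* a , subst X.cut (sym (halves a)) a∈
  ; bounded   = let u , u∉ = X.bounded in
                ½ ℚ.* u , u∉ ∘ subst X.cut (halves u)
  ; closed    = λ p<q → X.closed (ℚ.+-mono-< p<q p<q)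
  ; open′     = λ {q} q∈ → let r , q<r , r∈ = X.open′ q∈ in
                ½ ℚ.* r
                  , subst (ℚ._< ½ ℚ.* r) (half-double q) (ℚ.*-monoʳ-<-pos ½ q<r)
                  , subst X.cut (sym (halves r)) r∈
  }
  where module X = ℝ x

infixr 7 2^-_·_

2^-_·_ : ℕ → ℝ → ℝ
2^- n · x = fold x halve n

_⊔_ : ℝ → ℝ → ℝ
x ⊔ y = record
  { cut       = λ q → q ∈ X.cut ⊎ q ∈ Y.cut
  ; inhabited = let a , a∈ = X.inhabited in a , inj₁ a∈
  ; bounded   = let u , u∉ = X.bounded ; v , v∉ = Y.bounded in bound u∉ v∉
  ; closed    = λ p<q → [ inj₁ ∘ X.closed p<q , inj₂ ∘ Y.closed p<q ]′
  ; open′     = [ (λ q∈ → let r , q<r , r∈ = X.open′ q∈ in r , q<r , inj₁ r∈)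
                , (λ q∈ → let r , q<r , r∈ = Y.open′ q∈ in r , q<r , inj₂ r∈) ]′
  }
  where
  module X = ℝ x
  module Y = ℝ y
  bound : ∀ {u v} → u ∉ X.cut → v ∉ Y.cut → ∃[ q ] (q ∈ X.cut ⊎ q ∈ Y.cut → _)
  bound {u} {v} u∉ v∉ with ℚ.<-cmp u v
  ... | tri< u<v _ _  = v , [ u∉ ∘ X.closed u<v , v∉ ]′
  ... | tri≈ _ refl _ = u , [ u∉ , v∉ ]′
  ... | tri> _ _ v<u  = u , [ u∉ , v∉ ∘ Y.closed v<u ]′

Σ[i<_]_ : ℕ → (ℕ → ℝ) → ℝ
Σ[i< zero  ] f = 0ℝ
Σ[i< suc n ] f = (Σ[i< n ] f) + f n

IsLub IsGlb : {I : Set} → (I → ℝ) → ℝ → Set₁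
IsLub f x = (∀ i → f i ≤ x) × (∀ y → (∀ i → f i ≤ y) → x ≤ y)
IsGlb f x = (∀ i → x ≤ f i) × (∀ y → (∀ i → y ≤ f i) → y ≤ x)

IsMetric : {A : Set} → (A → A → ℝ) → Set₁
IsMetric = Metric.IsGeneralMetric _≡_ _≈_ _≤_ 0ℝ _+_

------------------------------------------------------------------------
-- Automata and languages

Language : Set → Set₁
Language E = Pred (List E) 0ℓ

record Automaton (E : Set) : Set₁ where
  field
    Q  : Set
    δ  : Q → E → Maybe Q
    q₀ : Q

  δ* : Q → List E → Maybe Q
  δ* q []      = just q
  δ* q (e ∷ s) = δ q e >>= λ q′ → δ* q′ s

L : {E : Set} → Automaton E → Language E
L G s = Is-just (δ* q₀ s)
  where open Automaton G

prefixClosure : {E : Set} → Language E → Language E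
prefixClosure A s = ∃[ t ] s ++ t ∈ A

infixl 7 _·_

_·_ : {E : Set} → Language E → Pred E 0ℓ → Language E
(A · F) s = ∃[ t ] ∃[ e ] t ∈ A × e ∈ F × s ≡ t ∷ʳ e

module Control
  (em : ExcludedMiddle (lsuc 0ℓ))
  {E : Set} (Euc : Pred E 0ℓ) (G : Automaton E)
  (d : E → E → ℝ) (l : ℝ)
  where

  -- Excluded middle brings the union of a large family of languages back
  -- to Set, so that it is again a language.
  ⋃ : {I : Set₁} → (I → Language E) → Language E
  ⋃ F s = True (em {∃[ i ] s ∈ F i})

  -- Only ever used for families bounded by 1, which have a least upper
  -- bound unless I is empty; sup ∅ = 0.
  sup : {I : Set} → (I → ℝ) → ℝ
  sup f with em {∃ (IsLub f)}
  ... | yes (x , _) = x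
  ... | no  _       = 0ℝ

  -- Only ever used for families bounded below by 0, which have a greatest
  -- lower bound unless I is empty; inf ∅ = 1, giving d(s,∅) = 1.
  inf : {I : Set} → (I → ℝ) → ℝ
  inf f with em {∃ (IsGlb f)}
  ... | yes (x , _) = x
  ... | no  _       = 1ℝ

  -- nothing plays the role of the padding symbol ε.
  dᵉ : Maybe E → Maybe E → ℝ
  dᵉ nothing  nothing  = 0ℝ
  dᵉ (just _) nothing  = 1ℝ
  dᵉ nothing  (just _) = 1ℝ
  dᵉ (just a) (just b) = d a b

  _!_ : List E → ℕ → Maybe E
  s ! i = head (drop i s)

  -- Letters are indexed from 0, so the i-th one has weight 2^-(i+1).
  dˢ : List E → List E → ℝ
  dˢ s t = Σ[i< length s ℕ.⊔ length t ] λ i → 2^- suc i · dᵉ (s ! i) (t ! i)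

  d-to : List E → Language E → ℝ
  d-to s A = inf {∃[ a ] a ∈ A} λ (a , _) → dˢ s a

  -- For A = B = ∅ both suprema are 0, so dᴴ ∅ ∅ = 0.
  dᴴ : Language E → Language E → ℝ
  dᴴ A B = sup {∃[ a ] a ∈ A} (λ (a , _) → d-to a B)
         ⊔ sup {∃[ b ] b ∈ B} (λ (b , _) → d-to b A)

  ball : List E → Language E
  ball s t = t ∈ L G × dˢ s t ≤ l

  Ball : Language E → Language E
  Ball K t = ∃[ s ] s ∈ K × t ∈ ball s

  Controllable : Language E → Set
  Controllable K = K ⊆ L G × (prefixClosure K · Euc) ∩ L G ⊆ prefixClosure K

  infix 8 _↑ _⇑

  _↑ : Language E → Language E
  K ↑ = ⋃ {∃[ M ] Controllable M × M ⊆ K} proj₁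

  _RealizationOf_ : Language E → Language E → Set
  K̃ RealizationOf K = Controllable K̃ × dᴴ K̃ K ≤ l

  λ-Controllable : Language E → Set₁
  λ-Controllable K = K ⊆ L G × ∃[ K̃ ] K̃ RealizationOf K

  _⇑ : Language E → Language E
  K ⇑ = ⋃ {∃[ M ] λ-Controllable M × M ⊆ K} proj₁

  record _SupremalRealizationOf_ (K̃ K : Language E) : Set₁ where
    field
      λ-controllable : λ-Controllable K
      isRealization  : K̃ RealizationOf K
      isUnion        : K̃ ≐ ⋃ {∃[ M ] M RealizationOf K} proj₁

{-# OPTIONS --safe #-}

-- Since E is finite, every distance d(s,A) with A ≠ ∅ is attained: by induction
-- on s, a nearest string of A is either ε or e u with u nearest to the tail of s
-- among the residuals of A by e, and a string nearest to ε is a shortest one.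
-- Hence d(A,B) ≤ λ says that every string of A is within λ of one of B and
-- conversely, up to the degenerate case λ = 1, B = ∅.  So every realization of a
-- sublanguage of K lies in B(K,λ), and hence in B(K,λ)↑.  Conversely, B(K,λ)↑
-- realizes the strings of K within λ of it, which are therefore in K⇑; and every
-- string of K⇑ is within λ of a realization of some M ⊆ K, hence of B(K,λ)↑.

module Submission where

open import Defs
open import Algebra.Bundles using (CommutativeMonoid)
import Algebra.Properties.CommutativeSemigroup as CommutativeSemigroup
open import Axiom.ExcludedMiddle using (ExcludedMiddle)
open import Data.Empty using (⊥-elim)
open import Data.Fin.Base using (Fin; zero; suc)
open import Data.List.Base using (List; []; _∷_; head; length)
open import Data.List.Properties using (++-identityʳ; drop-[])
open import Data.Maybe.Base using (just; nothing)
open import Data.Nat.Base as ℕ using (ℕ; zero; suc)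
open import Data.Nat.Induction using (<-wellFounded)
import Data.Nat.Properties as ℕ
open import Data.Product using (∃; ∃-syntax; _×_; _,_; proj₁; proj₂)
open import Data.Rational as ℚ using (ℚ; ½; 1ℚ)
import Data.Rational.Properties as ℚ
open import Data.Sum.Base using (_⊎_; inj₁; inj₂; [_,_]′)
open import Function.Base using (_∘_; case_of_)
open import Function.Bundles using (_↔_; Inverse)
import Function.Metric.Structures as Metric
open import Induction.WellFounded using (Acc; acc)
open import Level using (0ℓ; Lift; lift; lower) renaming (suc to lsuc)
open import Relation.Binary.Bundles using (Poset)
open import Relation.Binary.PropositionalEquality
import Relation.Binary.Reasoning.PartialOrder as PartialOrderReasoning
open import Relation.Nullary using (Dec; ¬_; yes; no; contradiction)
open import Relation.Nullary.Decidable using (map′; toWitness; fromWitness)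
open import Relation.Unary using (Pred; _∈_; _∉_; _⊆_; _≐_; _∪_; Satisfiable)

open ℝ using (cut)

-- Rational arithmetic of halves

halves-sum : ∀ q → ½ ℚ.* q ℚ.+ ½ ℚ.* q ≡ q
halves-sum q = trans (sym (ℚ.*-distribʳ-+ q ½ ½)) (ℚ.*-identityˡ q)

+-interchange : ∀ a b c d → (a ℚ.+ b) ℚ.+ (c ℚ.+ d) ≡ (a ℚ.+ c) ℚ.+ (b ℚ.+ d)
+-interchange = CommutativeSemigroup.interchange
  (CommutativeMonoid.commutativeSemigroup ℚ.+-0-commutativeMonoid)

half-+ : ∀ p q → ½ ℚ.* (p ℚ.+ q) ≡ ½ ℚ.* p ℚ.+ ½ ℚ.* q
half-+ = ℚ.*-distribˡ-+ ½

half-double : ∀ q → ½ ℚ.* (q ℚ.+ q) ≡ q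
half-double q = trans (half-+ q q) (halves-sum q)

double-cancel-< : ∀ {p q} → p ℚ.+ p ℚ.< q ℚ.+ q → p ℚ.< q
double-cancel-< {p} {q} lt =
  subst₂ ℚ._<_ (half-double p) (half-double q) (ℚ.*-monoʳ-<-pos ½ lt)

q<q+1 : ∀ q → q ℚ.< q ℚ.+ 1ℚ
q<q+1 q = subst (ℚ._< q ℚ.+ 1ℚ) (ℚ.+-identityʳ q) (ℚ.+-monoʳ-< q (ℚ.positive⁻¹ 1ℚ))

[q-r]+r : ∀ q r → (q ℚ.- r) ℚ.+ r ≡ q
[q-r]+r q r = trans (ℚ.+-assoc q (ℚ.- r) r)
  (trans (cong (q ℚ.+_) (ℚ.+-inverseˡ r)) (ℚ.+-identityʳ q))

-- Order, addition and halving of cuts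

ℝ-poset : Poset (lsuc 0ℓ) 0ℓ 0ℓ
ℝ-poset = record
  { Carrier        = ℝ
  ; _≈_            = _≈_
  ; _≤_            = _≤_
  ; isPartialOrder = record
    { isPreorder = record
      { isEquivalence = record
        { refl  = (λ p → p) , (λ p → p)
        ; sym   = λ (f , g) → g , f
        ; trans = λ (f , g) (h , k) → (λ p → h (f p)) , (λ p → g (k p))
        }
      ; reflexive = proj₁
      ; trans     = λ f g p → g (f p)
      }
    ; antisym = _,_
    }
  }

open Poset ℝ-poset using () renaming
  (trans to ≤-trans; module Eq to ≈)
open PartialOrderReasoning ℝ-poset

+-mono-≤ : ∀ {x x′ y y′} → x ≤ x′ → y ≤ y′ → x + y ≤ x′ + y′
+-mono-≤ f g (a , b , a∈ , b∈ , eq) = a , b , f a∈ , g b∈ , eq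

+-cong : ∀ {x x′ y y′} → x ≈ x′ → y ≈ y′ → x + y ≈ x′ + y′
+-cong {x} {x′} {y} {y′} (f , f⁻) (g , g⁻) =
  +-mono-≤ {x} {x′} {y} {y′} f g , +-mono-≤ {x′} {x} {y′} {y} f⁻ g⁻

+-comm-≤ : ∀ x y → x + y ≤ y + x
+-comm-≤ x y (a , b , a∈ , b∈ , eq) = b , a , b∈ , a∈ , trans eq (ℚ.+-comm a b)

+-comm : ∀ x y → x + y ≈ y + x
+-comm x y = +-comm-≤ x y , +-comm-≤ y x

+-assoc : ∀ x y z → (x + y) + z ≈ x + (y + z)
+-assoc x y z =
    (λ { (_ , c , (a , b , a∈ , b∈ , refl) , c∈ , refl) →
      a , b ℚ.+ c , a∈ , (b , c , b∈ , c∈ , refl) , ℚ.+-assoc a b c })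
  , (λ { (a , _ , a∈ , (b , c , b∈ , c∈ , refl) , refl) →
      a ℚ.+ b , c , (a , b , a∈ , b∈ , refl) , c∈ , sym (ℚ.+-assoc a b c) })

+-identityˡ : ∀ x → 0ℝ + x ≈ x
+-identityˡ x =
    (λ { (a , b , a<0 , b∈ , refl) → ℝ.closed x
      (subst (a ℚ.+ b ℚ.<_) (ℚ.+-identityˡ b) (ℚ.+-monoˡ-< b a<0)) b∈ })
  -- Openness gives `r` above `q` still in the cut, so `q ℚ.- r` is negative and `q` splits as a
  -- member of the sum.
  , (λ {q} q∈ → let r , q<r , r∈ = ℝ.open′ x q∈ in
      q ℚ.- r , r
        , subst (q ℚ.- r ℚ.<_) (ℚ.+-inverseʳ r) (ℚ.+-monoˡ-< (ℚ.- r) q<r)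
        , r∈ , sym ([q-r]+r q r))

halve-+-mono-≤ : ∀ {x x′ y y′} → x ≤ x′ → y ≤ y′ → halve (x + y) ≤ halve (x′ + y′)
halve-+-mono-≤ {x} {x′} {y} {y′} f g {q} = +-mono-≤ {x} {x′} {y} {y′} f g {q ℚ.+ q}

halve-cong : ∀ {x y} → x ≈ y → halve x ≈ halve y
halve-cong (f , g) = (λ p → f p) , (λ p → g p)

halve-0 : halve 0ℝ ≈ 0ℝ
halve-0 = double-cancel-< , λ q<0 → ℚ.+-mono-< q<0 q<0

halve-+ : ∀ x y → halve (x + y) ≈ halve x + halve y
halve-+ x y =
    (λ { {q} (a , b , a∈ , b∈ , eq) →
      ½ ℚ.* a , ½ ℚ.* b
        , subst (cut x) (sym (halves-sum a)) a∈
        , subst (cut y) (sym (halves-sum b)) b∈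
        , trans (sym (half-double q)) (trans (cong (½ ℚ.*_) eq) (half-+ a b)) })
  , (λ { (a , b , a∈ , b∈ , refl) →
      a ℚ.+ a , b ℚ.+ b , a∈ , b∈ , +-interchange a b a b })

halve-[1+1] : halve (1ℝ + 1ℝ) ≤ 1ℝ
halve-[1+1] (a , b , a<1 , b<1 , eq) =
  double-cancel-< (subst (ℚ._< 1ℚ ℚ.+ 1ℚ) (sym eq) (ℚ.+-mono-< a<1 b<1))

0≤1 : 0ℝ ≤ 1ℝ
0≤1 q<0 = ℚ.<-trans q<0 (ℚ.positive⁻¹ 1ℚ)

-- Every cut misses some rational, which a larger rational cut contains. This excludes greatest
-- lower bounds of empty families.
≤-no-maximum : ∀ x → ¬ (∀ y → y ≤ x)
≤-no-maximum x max = let q , q∉ = ℝ.bounded x in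
  q∉ (max (fromℚ (q ℚ.+ 1ℚ)) (q<q+1 q))

-- Dyadically weighted sums

weighted : ℕ → (ℕ → ℝ) → ℝ
weighted n x = Σ[i< n ] λ i → 2^- suc i · x i

2^-·-mono-≤ : ∀ n {x y} → x ≤ y → 2^- n · x ≤ 2^- n · y
2^-·-mono-≤ zero    x≤y p = x≤y p
2^-·-mono-≤ (suc n) {x} {y} x≤y {q} = 2^-·-mono-≤ n {x} {y} x≤y {q ℚ.+ q}

weighted-mono-≤ : ∀ n {x y} → (∀ i → x i ≤ y i) → weighted n x ≤ weighted n y
weighted-mono-≤ zero    x≤y p = p
weighted-mono-≤ (suc n) {x} {y} x≤y =
  +-mono-≤ {weighted n x} {weighted n y} {2^- suc n · x n} {2^- suc n · y n}
    (weighted-mono-≤ n {x} {y} x≤y)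
    (λ {q} → 2^-·-mono-≤ (suc n) {x n} {y n} (x≤y n) {q})

-- The sum is defined by splitting off its last term, whereas recursion on strings removes the first
-- letter. Distributivity of `halve` over `_+_` converts one form into the other.
weighted-suc : ∀ n x → weighted (suc n) x ≈ halve (x 0 + weighted n (x ∘ suc))
weighted-suc zero x = begin-equality
  0ℝ + halve (x 0)        ≈⟨ +-comm 0ℝ (halve (x 0)) ⟩
  halve (x 0) + 0ℝ        ≈⟨ +-cong {halve (x 0)} {halve (x 0)} {0ℝ} {halve 0ℝ}
                             (≈.refl {halve (x 0)}) (≈.sym {halve 0ℝ} {0ℝ} halve-0) ⟩
  halve (x 0) + halve 0ℝ  ≈⟨ halve-+ (x 0) 0ℝ ⟨
  halve (x 0 + 0ℝ)        ∎
weighted-suc (suc n) x = begin-equality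
  weighted (suc n) x + halve y    ≈⟨ +-cong {weighted (suc n) x} {halve (x 0 + w)} {halve y} {halve y}
                                     (weighted-suc n x) (≈.refl {halve y}) ⟩
  halve (x 0 + w) + halve y       ≈⟨ halve-+ (x 0 + w) y ⟨
  halve ((x 0 + w) + y)           ≈⟨ halve-cong {(x 0 + w) + y} {x 0 + (w + y)} (+-assoc (x 0) w y) ⟩
  halve (x 0 + (w + y))           ∎
  where
  w y : ℝ
  w = weighted n (x ∘ suc)
  -- The last term of the shifted sum; its half is the last term of the original one.
  y = 2^- suc n · x (suc n)

-- With the first term split off, the sum is the mean of two numbers that are at most 1, by
-- induction.
weighted≤1 : ∀ n {x} → (∀ i → x i ≤ 1ℝ) → weighted n x ≤ 1ℝ
weighted≤1 zero        x≤1 = 0≤1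
weighted≤1 (suc n) {x} x≤1 = begin
  weighted (suc n) x                  ≈⟨ weighted-suc n x ⟩
  halve (x 0 + weighted n (x ∘ suc))  ≤⟨ (λ {q} → halve-+-mono-≤
                                           {x 0} {1ℝ} {weighted n (x ∘ suc)} {1ℝ}
                                           (x≤1 0) (weighted≤1 n {x ∘ suc} (x≤1 ∘ suc)) {q}) ⟩
  halve (1ℝ + 1ℝ)                     ≤⟨ halve-[1+1] ⟩
  1ℝ                                  ∎

≡⇒≤ : ∀ {x y} → x ≡ y → x ≤ y
≡⇒≤ refl p = p

-- Attained minima and the classical order

Attains : {X : Set} → (X → ℝ) → Pred X 0ℓ → Set
Attains g P = Satisfiable P → ∃[ x ] x ∈ P × (∀ y → y ∈ P → g x ≤ g y)

attains-resp-≐ : ∀ {X} (g : X → ℝ) {P Q : Pred X 0ℓ} → P ≐ Q → Attains g P → Attains g Q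
attains-resp-≐ _ (P⊆Q , Q⊆P) attP (y , y∈Q) =
  let x , x∈P , x-min = attP (y , Q⊆P y∈Q) in
  x , P⊆Q x∈P , λ z z∈Q → x-min z (Q⊆P z∈Q)

module Classical (em : ExcludedMiddle (lsuc 0ℓ)) where

  dec : (A : Set) → Dec A
  dec A = map′ lower lift (em {Lift (lsuc 0ℓ) A})

  ≤-total : ∀ x y → x ≤ y ⊎ y ≤ x
  ≤-total x y with dec (∃[ q ] q ∈ cut x × q ∉ cut y)
  -- A rational in `x` but not in `y` lies above all of `y`, and `x` is closed downwards.
  ... | yes (q , q∈ , q∉) = inj₂ λ r∈ → ℝ.closed x (ℝ.below y r∈ q∉) q∈
  ... | no  none          = inj₁ λ {q} q∈ → case dec (q ∈ cut y) of λ where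
    (yes q∈y) → q∈y
    (no  q∉y) → contradiction (q , q∈ , q∉y) none

  module _ {X : Set} (g : X → ℝ) where

    attains-∪ : ∀ {P Q : Pred X 0ℓ} → Attains g P → Attains g Q → Attains g (P ∪ Q)
    attains-∪ {P} {Q} attP attQ (z , z∈) with dec (Satisfiable P) | dec (Satisfiable Q)
    ... | no ∄P | no ∄Q =
      contradiction z∈ [ (λ z∈P → ∄P (z , z∈P)) , (λ z∈Q → ∄Q (z , z∈Q)) ]′
    ... | yes ∃P | no ∄Q = let x , x∈P , x-min = attP ∃P in
      x , inj₁ x∈P , λ y → [ x-min y , (λ y∈Q → contradiction (y , y∈Q) ∄Q) ]′
    ... | no ∄P | yes ∃Q = let x , x∈Q , x-min = attQ ∃Q in
      x , inj₂ x∈Q , λ y → [ (λ y∈P → contradiction (y , y∈P) ∄P) , x-min y ]′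
    ... | yes ∃P | yes ∃Q with attP ∃P | attQ ∃Q
    ...   | x , x∈P , x-min | y , y∈Q , y-min with ≤-total (g x) (g y)
    ...     | inj₁ x≤y = x , inj₁ x∈P , λ z →
      [ x-min z , (λ z∈Q → ≤-trans {g x} {g y} {g z} x≤y (y-min z z∈Q)) ]′
    ...     | inj₂ y≤x = y , inj₂ y∈Q , λ z →
      [ (λ z∈P → ≤-trans {g y} {g x} {g z} y≤x (x-min z z∈P)) , y-min z ]′

    -- Minima of finitely many pieces are compared in turn; an infinite union could fail to attain
    -- its infimum.
    attains-⋃ : ∀ n (P : Fin n → Pred X 0ℓ) →
                (∀ i → Attains g (P i)) → Attains g (λ x → ∃[ i ] x ∈ P i)
    attains-⋃ zero    P att (_ , () , _)
    attains-⋃ (suc n) P att = attains-resp-≐ g {P = P zero ∪ tail} {Q = λ x → ∃[ i ] x ∈ P i}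
      ( [ (zero ,_) , (λ (i , x∈) → suc i , x∈) ]′
      , (λ { (zero , x∈) → inj₁ x∈ ; (suc i , x∈) → inj₂ (i , x∈) }) )
      (attains-∪ {P zero} {tail} (att zero) (attains-⋃ n (P ∘ suc) (att ∘ suc)))
      where
      tail : Pred X 0ℓ
      tail x = ∃[ i ] x ∈ P (suc i)

-- The union of the cuts is the supremum. The index `i` makes it inhabited, and `b` keeps it from
-- being all of ℚ.
lub-exists : ∀ {I} {f : I → ℝ} {b} → I → (∀ i → f i ≤ b) → ∃ (IsLub f)
lub-exists {f = f} {b} i f≤b = record
  { cut       = λ q → ∃[ j ] q ∈ cut (f j)
  ; inhabited = let q , q∈ = ℝ.inhabited (f i) in q , i , q∈
  ; bounded   = let q , q∉ = ℝ.bounded b in q , λ (j , q∈) → q∉ (f≤b j q∈)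
  ; closed    = λ p<q (j , q∈) → j , ℝ.closed (f j) p<q q∈
  ; open′     = λ (j , q∈) → let r , q<r , r∈ = ℝ.open′ (f j) q∈ in r , q<r , j , r∈
  } , (λ j q∈ → j , q∈) , λ _ f≤y (j , q∈) → f≤y j q∈

module Realization
  (em : ExcludedMiddle (lsuc 0ℓ))
  {E : Set} {n : ℕ} (finite : E ↔ Fin n)
  (Euc : Pred E 0ℓ) (G : Automaton E)
  (d : E → E → ℝ) (metric : IsMetric d) (d≤1 : ∀ a b → d a b ≤ 1ℝ)
  (l : ℝ) (0≤l : 0ℝ ≤ l) (l≤1 : l ≤ 1ℝ)
  where

  open Classical em
  open Control em Euc G d l

  -- The distance between strings

  dᵉ-sym : ∀ a b → dᵉ a b ≤ dᵉ b a
  dᵉ-sym nothing  nothing  p = p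
  dᵉ-sym nothing  (just _) p = p
  dᵉ-sym (just _) nothing  p = p
  dᵉ-sym (just a) (just b)   = proj₁ (Metric.IsGeneralMetric.sym metric a b)

  dᵉ≤1 : ∀ a b → dᵉ a b ≤ 1ℝ
  dᵉ≤1 nothing  nothing    = 0≤1
  dᵉ≤1 nothing  (just _) p = p
  dᵉ≤1 (just _) nothing  p = p
  dᵉ≤1 (just a) (just b)   = d≤1 a b

  dˢ-sym : ∀ s t → dˢ s t ≤ dˢ t s
  dˢ-sym s t rewrite ℕ.⊔-comm (length t) (length s) =
    weighted-mono-≤ (length s ℕ.⊔ length t)
      {λ i → dᵉ (s ! i) (t ! i)} {λ i → dᵉ (t ! i) (s ! i)}
      λ i → dᵉ-sym (s ! i) (t ! i)

  dˢ≤1 : ∀ s t → dˢ s t ≤ 1ℝ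
  dˢ≤1 s t = weighted≤1 (length s ℕ.⊔ length t)
    {λ i → dᵉ (s ! i) (t ! i)} λ i → dᵉ≤1 (s ! i) (t ! i)

  dˢ-∷-∷ : ∀ x s y t → dˢ (x ∷ s) (y ∷ t) ≈ halve (d x y + dˢ s t)
  dˢ-∷-∷ x s y t =
    weighted-suc (length s ℕ.⊔ length t) λ i → dᵉ ((x ∷ s) ! i) ((y ∷ t) ! i)

  dˢ-∷-mono-≤ : ∀ x s y {t u} → dˢ s t ≤ dˢ s u → dˢ (x ∷ s) (y ∷ t) ≤ dˢ (x ∷ s) (y ∷ u)
  dˢ-∷-mono-≤ x s y {t} {u} t≤u = begin
    dˢ (x ∷ s) (y ∷ t)      ≈⟨ dˢ-∷-∷ x s y t ⟩
    halve (d x y + dˢ s t)  ≤⟨ (λ {q} → halve-+-mono-≤ {d x y} {d x y} {dˢ s t} {dˢ s u}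
                                 (λ p → p) t≤u {q}) ⟩
    halve (d x y + dˢ s u)  ≈⟨ dˢ-∷-∷ x s y u ⟨
    dˢ (x ∷ s) (y ∷ u)      ∎

  dˢ-[]-∷ : ∀ y t → dˢ [] (y ∷ t) ≈ halve (1ℝ + dˢ [] t)
  dˢ-[]-∷ y t = begin-equality
    dˢ [] (y ∷ t)         ≈⟨ weighted-suc (length t) (λ i → dᵉ ([] ! i) ((y ∷ t) ! i)) ⟩
    halve (1ℝ + w)        ≈⟨ halve-cong {1ℝ + w} {1ℝ + dˢ [] t}
                             (+-cong {1ℝ} {1ℝ} {w} {dˢ [] t} (≈.refl {1ℝ}) w≈dˢ) ⟩
    halve (1ℝ + dˢ [] t)  ∎
    where
    padded : ℕ → ℝ
    padded i = dᵉ nothing (t ! i)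

    -- `[] ! i` does not reduce for a variable `i`, so padding the empty string has to be unfolded
    -- by a lemma.
    []! : ∀ i → dᵉ ([] ! i) (t ! i) ≡ padded i
    []! i = cong (λ u → dᵉ (head u) (t ! i)) (drop-[] i)

    w : ℝ
    w = weighted (length t) padded

    w≈dˢ : w ≈ dˢ [] t
    w≈dˢ =
        weighted-mono-≤ (length t) {padded} {λ i → dᵉ ([] ! i) (t ! i)} (≡⇒≤ ∘ sym ∘ []!)
      , weighted-mono-≤ (length t) {λ i → dᵉ ([] ! i) (t ! i)} {padded} (≡⇒≤ ∘ []!)

  -- Each letter has distance 1 from the padding symbol, so a string of length n is at distance 1 -
  -- 2^-n from ε, whatever its letters.
  dˢ-[]-mono-≤ : ∀ s t → length s ℕ.≤ length t → dˢ [] s ≤ dˢ [] t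
  dˢ-[]-mono-≤ []      []      _ p = p
  dˢ-[]-mono-≤ []      (y ∷ t) _   = begin
    0ℝ                    ≈⟨ halve-0 ⟨
    halve 0ℝ              ≈⟨ halve-cong {0ℝ + 0ℝ} {0ℝ} (+-identityˡ 0ℝ) ⟨
    halve (0ℝ + 0ℝ)       ≤⟨ (λ {q} → halve-+-mono-≤ {0ℝ} {1ℝ} {0ℝ} {dˢ [] t}
                               0≤1 (dˢ-[]-mono-≤ [] t ℕ.z≤n) {q}) ⟩
    halve (1ℝ + dˢ [] t)  ≈⟨ dˢ-[]-∷ y t ⟨
    dˢ [] (y ∷ t)         ∎
  dˢ-[]-mono-≤ (x ∷ s) (y ∷ t) (ℕ.s≤s s≤t) = begin
    dˢ [] (x ∷ s)         ≈⟨ dˢ-[]-∷ x s ⟩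
    halve (1ℝ + dˢ [] s)  ≤⟨ (λ {q} → halve-+-mono-≤ {1ℝ} {1ℝ} {dˢ [] s} {dˢ [] t}
                               (λ p → p) (dˢ-[]-mono-≤ s t s≤t) {q}) ⟩
    halve (1ℝ + dˢ [] t)  ≈⟨ dˢ-[]-∷ y t ⟨
    dˢ [] (y ∷ t)         ∎

  -- Existence of nearest strings

  shortest : ∀ (A : Language E) s → Acc ℕ._<_ (length s) → s ∈ A →
             ∃[ t ] t ∈ A × (∀ u → u ∈ A → length t ℕ.≤ length u)
  shortest A s (acc rec) s∈A with dec (∃[ t ] t ∈ A × length t ℕ.< length s)
  ... | yes (t , t∈A , t<s) = shortest A t (rec t<s) t∈A
  ... | no  none            = s , s∈A , λ u u∈A → ℕ.≮⇒≥ λ u<s → none (u , u∈A , u<s)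

  -- The language varies in the induction on `s`, because the recursive call concerns residuals of
  -- `A`. Finiteness of `E` enters in the split of `A` by first letter.
  dˢ-attains : ∀ s A → Attains (dˢ s) A
  dˢ-attains [] A (a , a∈A) =
    let t , t∈A , t-min = shortest A a (<-wellFounded (length a)) a∈A in
    t , t∈A , λ u u∈A → dˢ-[]-mono-≤ t u (t-min u u∈A)
  dˢ-attains (x ∷ s) A = attains-resp-≐ (dˢ (x ∷ s)) {P = A[] ∪ A∷} {Q = A}
    ( [ proj₂ , (λ { (_ , _ , refl , t∈A) → t∈A }) ]′
    , (λ { {[]}    t∈A → inj₁ (refl , t∈A)
         ; {y ∷ t} t∈A → inj₂ (to y , t , cong (_∷ t) (sym (strictlyInverseʳ y)) , t∈A) }) )
    (attains-∪ (dˢ (x ∷ s)) {P = A[]} {Q = A∷}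
      (λ { (_ , refl , []∈A) → [] , (refl , []∈A) , λ { _ (refl , _) p → p } })
      (attains-⋃ (dˢ (x ∷ s)) n (startingWith ∘ from) (attains-startingWith ∘ from)))
    where
    open Inverse finite

    startingWith : E → Language E
    startingWith y t = ∃[ u ] t ≡ y ∷ u × t ∈ A

    A[] A∷ : Language E
    A[] t = t ≡ [] × t ∈ A
    A∷ t = ∃[ i ] t ∈ startingWith (from i)

    -- All strings of the piece share the first letter `y`, which contributes the same `d x y`; only
    -- the tails compete.
    attains-startingWith : ∀ y → Attains (dˢ (x ∷ s)) (startingWith y)
    attains-startingWith y (_ , u , refl , u∈) =
      let v , v∈ , v-min = dˢ-attains s (λ u → y ∷ u ∈ A) (u , u∈) in
      y ∷ v , (v , refl , v∈) , λ { _ (w , refl , w∈) → dˢ-∷-mono-≤ x s y {v} {w} (v-min w w∈) }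

  -- Infima, suprema and the Hausdorff distance

  inf-isGlb : ∀ {I} {f : I → ℝ} → ∃ (IsGlb f) → IsGlb f (inf f)
  inf-isGlb {f = f} glb with em {∃ (IsGlb f)}
  ... | yes (_ , isGlb) = isGlb
  ... | no  none        = contradiction glb none

  -- Every real bounds an empty family from below, so none is greatest and `inf` falls back on its
  -- default.
  inf-empty : ∀ {I} {f : I → ℝ} → ¬ I → inf f ≡ 1ℝ
  inf-empty {f = f} ∄i with em {∃ (IsGlb f)}
  ... | yes (x , _ , max) = ⊥-elim (≤-no-maximum x λ y → max y λ i → contradiction i ∄i)
  ... | no  _             = refl

  sup-isLub : ∀ {I} {f : I → ℝ} → ∃ (IsLub f) → IsLub f (sup f)
  sup-isLub {f = f} lub with em {∃ (IsLub f)}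
  ... | yes (_ , isLub) = isLub
  ... | no  none        = contradiction lub none

  sup≤ : ∀ {I} {f : I → ℝ} {y} → 0ℝ ≤ y → (∀ i → f i ≤ y) → sup f ≤ y
  sup≤ {f = f} {y} 0≤y f≤y with em {∃ (IsLub f)}
  ... | yes (_ , _ , min) = min y f≤y
  -- Here `sup` has its default value 0, which is why `y` must be nonnegative.
  ... | no  _             = 0≤y

  d-to-isGlb : ∀ s {A} → Satisfiable A → IsGlb {∃[ a ] a ∈ A} (λ (a , _) → dˢ s a) (d-to s A)
  d-to-isGlb s {A} ∃A = let a , a∈A , a-min = dˢ-attains s A ∃A in
    inf-isGlb (dˢ s a , (λ (b , b∈A) → a-min b b∈A) , λ _ y≤ → y≤ (a , a∈A))

  near⇒d-to≤ : ∀ s {A x a} → a ∈ A → dˢ s a ≤ x → d-to s A ≤ x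
  near⇒d-to≤ s {A} {x} {a} a∈A sa≤x =
    ≤-trans {d-to s A} {dˢ s a} {x} (proj₁ (d-to-isGlb s (a , a∈A)) (a , a∈A)) sa≤x

  -- Since the infimum is attained, a non-strict bound on it already yields a witness, with no loss
  -- in `x`.
  d-to≤⇒near : ∀ s {A x} → Satisfiable A → d-to s A ≤ x → ∃[ a ] a ∈ A × dˢ s a ≤ x
  d-to≤⇒near s {A} {x} ∃A sA≤x = let a , a∈A , a-min = dˢ-attains s A ∃A in
    a , a∈A , ≤-trans {dˢ s a} {d-to s A} {x}
      (proj₂ (d-to-isGlb s ∃A) (dˢ s a) λ (b , b∈A) → a-min b b∈A) sA≤x

  d-to-empty : ∀ s {A} → (∀ {a} → a ∉ A) → d-to s A ≡ 1ℝ
  d-to-empty s {A} ∄A = inf-empty {∃[ a ] a ∈ A} λ (_ , a∈A) → ∄A a∈A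

  d-to≤1 : ∀ s A → d-to s A ≤ 1ℝ
  d-to≤1 s A with dec (Satisfiable A)
  ... | yes (a , a∈A) = near⇒d-to≤ s {A} {1ℝ} a∈A (dˢ≤1 s a)
  ... | no  ∄A        = ≡⇒≤ (d-to-empty s λ a∈A → ∄A (_ , a∈A))

  -- Phrased with `d-to` instead of a nearby string: if `l` is 1, it holds for empty `B`, where no
  -- such string exists.
  Near : Language E → Language E → Set
  Near A B = ∀ {a} → a ∈ A → d-to a B ≤ l

  near⇒dᴴ≤ : ∀ {A B} → Near A B → Near B A → dᴴ A B ≤ l
  near⇒dᴴ≤ {A} {B} nearA nearB =
    [ sup≤ {∃[ a ] a ∈ A} {λ (a , _) → d-to a B} {l} 0≤l (λ (_ , a∈A) → nearA a∈A)
    , sup≤ {∃[ b ] b ∈ B} {λ (b , _) → d-to b A} {l} 0≤l (λ (_ , b∈B) → nearB b∈B) ]′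

  sup-d-to≤⇒near : ∀ {A B} → sup {∃[ a ] a ∈ A} (λ (a , _) → d-to a B) ≤ l → Near A B
  sup-d-to≤⇒near {A} {B} sup≤l {a} a∈A p =
    -- The string `a` makes the family nonempty and 1 bounds it, so `sup` is a true least upper
    -- bound here.
    sup≤l (proj₁ (sup-isLub (lub-exists {f = f} {b = 1ℝ} (a , a∈A) λ (b , _) → d-to≤1 b B))
                 (a , a∈A) p)
    where
    f : ∃[ a ] a ∈ A → ℝ
    f (a , _) = d-to a B

  realization-near : ∀ {M̃ M} → M̃ RealizationOf M → Near M̃ M × Near M M̃
  realization-near (_ , dᴴ≤l) = sup-d-to≤⇒near (dᴴ≤l ∘ inj₁) , sup-d-to≤⇒near (dᴴ≤l ∘ inj₂)

  d-to-∅≤l⇒1≤l : ∀ s {A} → (∀ {a} → a ∉ A) → d-to s A ≤ l → 1ℝ ≤ l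
  d-to-∅≤l⇒1≤l s {A} ∄A = ≤-trans {1ℝ} {d-to s A} {l} (≡⇒≤ (sym (d-to-empty s ∄A)))

  -- Controllable languages and their unions

  ∈-⋃ : ∀ {I : Set₁} {F : I → Language E} {s} i → s ∈ F i → s ∈ ⋃ F
  ∈-⋃ i s∈ = fromWitness (i , s∈)

  -- A prefix of a string of the union is a prefix of a string of a single member, whose
  -- controllability applies.
  ⋃-controllable : ∀ {I : Set₁} {F : I → Language E} →
                   (∀ i → Controllable (F i)) → Controllable (⋃ F)
  ⋃-controllable {F = F} ctrl =
      (λ s∈ → let i , s∈F = toWitness s∈ in proj₁ (ctrl i) s∈F)
    , (λ { ((t , e , (u , tu∈) , e∈ , eq) , s∈L) →
        let i , tu∈F = toWitness tu∈
            v , sv∈F = proj₂ (ctrl i) ((t , e , (u , tu∈F) , e∈ , eq) , s∈L)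
        in v , ∈-⋃ {F = F} i sv∈F })

  L-controllable : Controllable (L G)
  L-controllable = (λ s∈L → s∈L) , λ {s} (_ , s∈L) → [] , subst (L G) (sym (++-identityʳ s)) s∈L

  ↑-controllable : ∀ A → Controllable (A ↑)
  ↑-controllable A = ⋃-controllable {F = proj₁} λ (_ , ctrl , _) → ctrl

  ↑-⊆ : ∀ A → A ↑ ⊆ A
  ↑-⊆ A s∈ = let (_ , _ , M⊆A) , s∈M = toWitness s∈ in M⊆A s∈M

  ↑-maximal : ∀ {A M} → Controllable M → M ⊆ A → M ⊆ A ↑
  ↑-maximal {A} {M} ctrl M⊆A = ∈-⋃ {F = proj₁} (M , ctrl , λ {_} → M⊆A)

  L⊆Ball : ∀ {K} → 1ℝ ≤ l → Satisfiable K → L G ⊆ Ball K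
  L⊆Ball 1≤l (s , s∈K) {t} t∈L = s , s∈K , t∈L , ≤-trans {dˢ s t} {1ℝ} {l} (dˢ≤1 s t) 1≤l

  -- The supremal realization

  module _ (K : Language E) (K⊆L : K ⊆ L G) (λ≈1⇒K : l ≈ 1ℝ → Satisfiable K) where

    realization⊆Ball : ∀ {M̃ M} → M ⊆ K → M̃ RealizationOf M → M̃ ⊆ Ball K
    realization⊆Ball {M̃} {M} M⊆K real {t} t∈M̃ with dec (Satisfiable M)
    ... | yes ∃M =
      let s , s∈M , ts≤l = d-to≤⇒near t {x = l} ∃M (proj₁ (realization-near real) t∈M̃) in
      s , M⊆K s∈M , proj₁ (proj₁ real) t∈M̃ , ≤-trans {dˢ s t} {dˢ t s} {l} (dˢ-sym s t) ts≤l
    -- Distance to an empty `M` is 1, which forces `l` to be 1; then `K` is nonempty and its ball is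
    -- all of `L G`. Were `K` empty too, its ball would be empty although `L G` realizes ∅.
    ... | no ∄M = L⊆Ball 1≤l (λ≈1⇒K (l≤1 , 1≤l)) (proj₁ (proj₁ real) t∈M̃)
      where
      1≤l : 1ℝ ≤ l
      1≤l = d-to-∅≤l⇒1≤l t (λ a∈M → ∄M (_ , a∈M)) (proj₁ (realization-near real) t∈M̃)

    realization⊆Ball↑ : ∀ {M̃ M} → M ⊆ K → M̃ RealizationOf M → M̃ ⊆ Ball K ↑
    realization⊆Ball↑ M⊆K real = ↑-maximal (proj₁ real) (realization⊆Ball M⊆K real)

    K⇑⊆K : K ⇑ ⊆ K
    K⇑⊆K s∈ = let (_ , _ , M⊆K) , s∈M = toWitness s∈ in M⊆K s∈M

    -- The part of `K` that `Ball K ↑` can realize; other strings of `K` may be too far from it.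
    covered : Language E
    covered s = s ∈ K × ∃[ t ] t ∈ Ball K ↑ × dˢ s t ≤ l

    -- The centre `s` of a ball containing `t` is covered, with `t` itself as the witness. The
    -- superset `A` is left open to serve both `covered` and `K ⇑`.
    Ball↑-near : ∀ {A} → covered ⊆ A → Near (Ball K ↑) A
    Ball↑-near covered⊆A {t} t∈ = let s , s∈K , _ , st≤l = ↑-⊆ (Ball K) t∈ in
      near⇒d-to≤ t {x = l} {s} (covered⊆A (s∈K , t , t∈ , st≤l))
        (≤-trans {dˢ t s} {dˢ s t} {l} (dˢ-sym t s) st≤l)

    covered-λ-controllable : λ-Controllable covered
    covered-λ-controllable = K⊆L ∘ proj₁ , Ball K ↑ , ↑-controllable (Ball K) ,
      near⇒dᴴ≤ (Ball↑-near λ s∈ → s∈) λ {s} (_ , _ , t∈ , st≤l) → near⇒d-to≤ s {x = l} t∈ st≤l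

    covered⊆K⇑ : covered ⊆ K ⇑
    covered⊆K⇑ = ∈-⋃ {F = proj₁} (covered , covered-λ-controllable , λ {_} → proj₁)

    K⇑-near-Ball↑ : Near (K ⇑) (Ball K ↑)
    K⇑-near-Ball↑ {s} s∈ with toWitness s∈
    ... | (M , (_ , M̃ , real) , M⊆K) , s∈M with dec (Satisfiable M̃)
    ...   | yes ∃M̃ =
      let t , t∈M̃ , st≤l = d-to≤⇒near s {x = l} ∃M̃ (proj₂ (realization-near real) s∈M) in
      near⇒d-to≤ s {x = l} (realization⊆Ball↑ M⊆K real t∈M̃) st≤l
    -- Again `l` is 1. The ball of `K` contains the controllable language `L G`, so `s` itself lies
    -- in `Ball K ↑` and serves as its own nearby string.
    ...   | no ∄M̃ = near⇒d-to≤ s {x = l}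
      (↑-maximal L-controllable (L⊆Ball 1≤l (s , M⊆K s∈M)) (K⊆L (M⊆K s∈M)))
      (≤-trans {dˢ s s} {1ℝ} {l} (dˢ≤1 s s) 1≤l)
      where
      1≤l : 1ℝ ≤ l
      1≤l = d-to-∅≤l⇒1≤l s (λ a∈M̃ → ∄M̃ (_ , a∈M̃)) (proj₂ (realization-near real) s∈M)

    Ball↑-realizes-K⇑ : (Ball K ↑) RealizationOf (K ⇑)
    Ball↑-realizes-K⇑ = ↑-controllable (Ball K) , near⇒dᴴ≤ (Ball↑-near covered⊆K⇑) K⇑-near-Ball↑

    Ball↑-supremalRealization : (Ball K ↑) SupremalRealizationOf (K ⇑)
    Ball↑-supremalRealization = record
      { λ-controllable = K⊆L ∘ K⇑⊆K , Ball K ↑ , Ball↑-realizes-K⇑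
      ; isRealization  = Ball↑-realizes-K⇑
      ; isUnion        = ∈-⋃ {F = proj₁} (Ball K ↑ , Ball↑-realizes-K⇑)
                       -- A realization of `K ⇑` realizes a sublanguage of `K`, hence lies in
                       -- `Ball K ↑`.
                       , λ s∈ → let (_ , real) , s∈M̃ = toWitness s∈ in
                           realization⊆Ball↑ K⇑⊆K real s∈M̃
      }

theorem3 :
    (em : ExcludedMiddle (lsuc 0ℓ))
    {E : Set} {n : ℕ} (finite : E ↔ Fin n)
    (Euc : Pred E 0ℓ) (G : Automaton E)
    (d : E → E → ℝ) → IsMetric d → (∀ a b → d a b ≤ 1ℝ) →
    (l : ℝ) → 0ℝ ≤ l → l ≤ 1ℝ →
    (K : Language E) → K ⊆ L G →
    (l ≈ 1ℝ → Satisfiable K) →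
    let open Control em Euc G d l in
    (Ball K ↑) SupremalRealizationOf (K ⇑)
theorem3 em finite Euc G d metric d≤1 l 0≤l l≤1 =
  Realization.Ball↑-supremalRealization em finite Euc G d metric d≤1 l 0≤l l≤1
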